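{- For $n\ge2$ and $0\le k\le n$ let $T(n,k)=(n+1)^{k-1}\binom{2n-k}{n}$. Then for every $n\ge2$ the sequence $T(n,n),T(n,n-1),\ldots,T(n,0)$ is log-concave.
   Context: A sequence $s_0,\ldots,s_N$ of nonnegative integers is log-concave if $s_i^2\ge s_{i-1}s_{i+1}$ for $0<i<N$. (The numbers $T(n,k)$ are nonnegative integers, the entries of the "parking triangle".) -}

module Defs where

open import Data.Nat using (ℕ; zero; suc; _+_; _*_; _∸_; _^_; _≤_; _<_; _/_)
open import Data.Nat.Properties
open import Data.Nat.Combinatorics using (_C_; nC1≡n; nCk+nC[k+1]≡[n+1]C[k+1])
open import Data.Nat.Divisibility using (_∣_; divides; ∣m+n∣m⇒∣n)
open import Data.Nat.DivMod using (m*[n/m]≡n)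
open import Data.Nat.Solver using (module +-*-Solver)
open import Relation.Binary.PropositionalEquality
  using (_≡_; refl; sym; trans; cong; cong₂; module ≡-Reasoning)

-- The finite sequence s 0 , … , s N is the restriction of s to 0 ≤ i ≤ N;
-- only these values are ever inspected.
LogConcave : (N : ℕ) → (ℕ → ℕ) → Set
LogConcave N s = ∀ i → 0 < i → i < N → s (i ∸ 1) * s (i + 1) ≤ s i ^ 2

-- T n k = (n+1)^(k-1) · binom(2n-k, n) for 0 ≤ k ≤ n.  At k = 0 the exponent
-- is -1, and the division is exact (see T-exact), giving the Catalan number.
T : ℕ → ℕ → ℕ
T n zero    = ((2 * n) C n) / suc n
T n (suc k) = suc n ^ k * ((2 * n ∸ suc k) C n)

private
  C-ratio : ∀ n k → suc k * (n C suc k) + k * (n C k) ≡ n * (n C k)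
  C-ratio n zero = begin
    1 * (n C 1) + 0  ≡⟨ +-identityʳ _ ⟩
    1 * (n C 1)      ≡⟨ *-identityˡ _ ⟩
    n C 1            ≡⟨ nC1≡n n ⟩
    n                ≡⟨ *-identityʳ n ⟨
    n * 1            ∎
    where open ≡-Reasoning
  C-ratio zero (suc k) = cong₂ _+_ (*-zeroʳ (suc (suc k))) (*-zeroʳ (suc k))
  C-ratio (suc n) (suc k) = begin
    suc (suc k) * (suc n C suc (suc k)) + suc k * (suc n C suc k)
      ≡⟨ cong₂ (λ x y → suc (suc k) * x + suc k * y)
           (nCk+nC[k+1]≡[n+1]C[k+1] n (suc k)) (nCk+nC[k+1]≡[n+1]C[k+1] n k) ⟨
    suc (suc k) * (b + c) + suc k * (a + b)
      ≡⟨ solve 4 (λ k a b c →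
           (con 2 :+ k) :* (b :+ c) :+ (con 1 :+ k) :* (a :+ b)
           := ((con 2 :+ k) :* c :+ (con 1 :+ k) :* b)
              :+ ((con 1 :+ k) :* b :+ k :* a) :+ (a :+ b)) refl k a b c ⟩
    (suc (suc k) * c + suc k * b) + (suc k * b + k * a) + (a + b)
      ≡⟨ cong₂ (λ x y → x + y + (a + b)) (C-ratio n (suc k)) (C-ratio n k) ⟩
    n * b + n * a + (a + b)
      ≡⟨ solve 3 (λ n a b →
           n :* b :+ n :* a :+ (a :+ b) := (con 1 :+ n) :* (a :+ b)) refl n a b ⟩
    suc n * (a + b)
      ≡⟨ cong (suc n *_) (nCk+nC[k+1]≡[n+1]C[k+1] n k) ⟩
    suc n * (suc n C suc k) ∎
    where
    open ≡-Reasoning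
    open +-*-Solver
    a b c : ℕ
    a = n C k
    b = n C suc k
    c = n C suc (suc k)

  n+1∣2nCn : ∀ n → suc n ∣ (2 * n) C n
  n+1∣2nCn n = ∣m+n∣m⇒∣n (divides a eq₂) (divides b eq₁)
    where
    open +-*-Solver
    a b : ℕ
    a = (2 * n) C n
    b = (2 * n) C suc n
    eq₁ : n * a ≡ b * suc n
    eq₁ = sym (+-cancelʳ-≡ (n * a) (b * suc n) (n * a)
      (trans (solve 3 (λ n a b → b :* (con 1 :+ n) :+ n :* a
                              := (con 1 :+ n) :* b :+ n :* a) refl n a b)
      (trans (C-ratio (2 * n) n)
             (solve 2 (λ n a → con 2 :* n :* a := n :* a :+ n :* a) refl n a))))
    eq₂ : n * a + a ≡ a * suc n
    eq₂ = solve 2 (λ n a → n :* a :+ a := a :* (con 1 :+ n)) refl n a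

T-exact : ∀ n k → suc n * T n k ≡ suc n ^ k * ((2 * n ∸ k) C n)
T-exact n zero    = trans (m*[n/m]≡n (n+1∣2nCn n)) (sym (*-identityˡ _))
T-exact n (suc k) = sym (*-assoc (suc n) (suc n ^ k) _)

{-# OPTIONS --safe #-}

-- With N = n + 1 and Bᵢ = C(n+i, n), the term with index i is N^(n-i-1) Bᵢ.
-- The powers of N form a geometric progression and cancel, so the claim is
-- that Bᵢ is log-concave in i, that is, that B₍ᵢ₊₁₎ / Bᵢ = (n+i+1) / (i+1)
-- decreases with i.

module Submission where

open import Defs
open import Data.Nat using (ℕ; suc; _+_; _*_; _∸_; _^_; _!; _≤_)
open import Data.Nat.Combinatorics using (_C_; nCk≡n!/k![n-k]!; k![n∸k]!∣n!)
open import Data.Nat.DivMod using (m/n*n≡m)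
open import Data.Nat.Properties
open import Data.Nat.Solver using (module +-*-Solver)
open import Data.Product using (_,_)
open import Relation.Binary.PropositionalEquality
  using (_≡_; refl; sym; trans; cong; cong₂; module ≡-Reasoning)

open +-*-Solver using (solve; con; _:+_; _:*_; _:^_; _:=_)

nCk*k![n∸k]!≡n! : ∀ {n k} → k ≤ n → (n C k) * (k ! * (n ∸ k) !) ≡ n !
nCk*k![n∸k]!≡n! {n} {k} k≤n =
  trans (cong (_* (k ! * (n ∸ k) !)) (nCk≡n!/k![n-k]! k≤n))
        (m/n*n≡m (k![n∸k]!∣n! k≤n))
  where instance _ = k !* (n ∸ k) !≢0

[n+i]Cn*n!i!≡[n+i]! : ∀ n i → ((n + i) C n) * (n ! * i !) ≡ (n + i) !
[n+i]Cn*n!i!≡[n+i]! n i =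
  trans (cong (λ j → ((n + i) C n) * (n ! * j !)) (sym (m+n∸m≡n n i)))
        (nCk*k![n∸k]!≡n! (m≤m+n n i))

-- Multiplied by `n ! * i !`, both sides become the factorial of `n + i + 1`.
[n+i]Cn-ratio : ∀ n i →
  suc i * ((n + suc i) C n) ≡ suc (n + i) * ((n + i) C n)
[n+i]Cn-ratio n i = *-cancelʳ-≡ _ _ (n ! * i !) (begin
  suc i * b * (n ! * i !)
    ≡⟨ solve 4 (λ s b x y → s :* b :* (x :* y) := b :* (x :* (s :* y)))
         refl (suc i) b (n !) (i !) ⟩
  b * (n ! * suc i !)              ≡⟨ [n+i]Cn*n!i!≡[n+i]! n (suc i) ⟩
  (n + suc i) !                    ≡⟨ cong _! (+-suc n i) ⟩
  suc (n + i) * (n + i) !          ≡⟨ cong (suc (n + i) *_) ([n+i]Cn*n!i!≡[n+i]! n i) ⟨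
  suc (n + i) * (a * (n ! * i !))  ≡⟨ *-assoc (suc (n + i)) a _ ⟨
  suc (n + i) * a * (n ! * i !)    ∎)
  where
  open ≡-Reasoning
  instance _ = n !* i !≢0
  a b : ℕ
  a = (n + i) C n
  b = (n + suc i) C n

-- The factor `suc (n + i)` turns `a` into a multiple of `b`, and `suc (suc i)` does the same for
-- `c`. Only the coefficients of `b ^ 2` are left to compare.
[n+i]Cn-logConcave : ∀ n i →
  ((n + i) C n) * ((n + suc (suc i)) C n) ≤ ((n + suc i) C n) ^ 2
[n+i]Cn-logConcave n i = *-cancelˡ-≤ (suc (n + i) * suc (suc i)) (begin
  suc (n + i) * suc (suc i) * (a * c)
    ≡⟨ solve 4 (λ p q a c → p :* q :* (a :* c) := (p :* a) :* (q :* c))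
         refl (suc (n + i)) (suc (suc i)) a c ⟩
  (suc (n + i) * a) * (suc (suc i) * c)
    ≡⟨ cong₂ _*_ (sym ([n+i]Cn-ratio n i)) ([n+i]Cn-ratio n (suc i)) ⟩
  (suc i * b) * (suc (n + suc i) * b)
    ≡⟨ solve 3 (λ n i b → ((con 1 :+ i) :* b) :* ((con 1 :+ (n :+ (con 1 :+ i))) :* b)
                       := (con 1 :+ i) :* (con 2 :+ (n :+ i)) :* b :^ 2)
         refl n i b ⟩
  suc i * suc (suc (n + i)) * b ^ 2
    ≤⟨ *-monoˡ-≤ (b ^ 2) factors ⟩
  suc (n + i) * suc (suc i) * b ^ 2 ∎)
  where
  open ≤-Reasoning
  a b c : ℕ
  a = (n + i) C n
  b = (n + suc i) C n
  c = (n + suc (suc i)) C n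
  factors : suc i * suc (suc (n + i)) ≤ suc (n + i) * suc (suc i)
  -- The two products differ by exactly `n`.
  factors = m+n≤o⇒m≤o _ (≤-reflexive
    (solve 2 (λ n i → (con 1 :+ i) :* (con 2 :+ (n :+ i)) :+ n
                   := (con 1 :+ (n :+ i)) :* (con 2 :+ i)) refl n i))

-- The factor `suc n` raises the exponent `k - 1` to `k`, so one formula covers every term,
-- including the quotient at `k = 0`.
T-scaled : ∀ {n} i k → i + k ≡ n → suc n * T n k ≡ suc n ^ k * ((n + i) C n)
T-scaled {n} i k refl =
  trans (T-exact n k) (cong (λ m → suc n ^ k * (m C n)) (begin
    2 * n ∸ k        ≡⟨ cong (_∸ k) (solve 2 (λ i k →
                          con 2 :* (i :+ k) := (i :+ k) :+ i :+ k) refl i k) ⟩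
    (n + i + k) ∸ k  ≡⟨ m+n∸n≡m (n + i) k ⟩
    n + i            ∎))
  where open ≡-Reasoning

-- Here `j` is the sequence index of the left neighbour, and `l`, possibly `0`, is the parameter `k`
-- of the right one. Multiplying by `N * N` gives each factor the `N` that `T-scaled` asks for.
T-logConcave : ∀ n j l → j + suc (suc l) ≡ n →
  T n (suc (suc l)) * T n l ≤ T n (suc l) ^ 2
T-logConcave n j l eq = *-cancelˡ-≤ (N * N) (begin
  N * N * (T n (suc (suc l)) * T n l)
    ≡⟨ solve 3 (λ N x y → N :* N :* (x :* y) := (N :* x) :* (N :* y))
         refl N (T n (suc (suc l))) (T n l) ⟩
  (N * T n (suc (suc l))) * (N * T n l)
    ≡⟨ cong₂ _*_ (T-scaled j (suc (suc l)) eq) (T-scaled (suc (suc j)) l eq₂) ⟩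
  (N * (N * p) * a) * (p * c)
    -- The exponents `l + 2` and `l` have mean `l + 1`, so the powers of `N` combine to the square
    -- of the middle one, `N * p`.
    ≡⟨ solve 4 (λ N p a c → (N :* (N :* p) :* a) :* (p :* c)
                         := (N :* p) :^ 2 :* (a :* c)) refl N p a c ⟩
  (N * p) ^ 2 * (a * c)
    ≤⟨ *-monoʳ-≤ ((N * p) ^ 2) ([n+i]Cn-logConcave n j) ⟩
  (N * p) ^ 2 * b ^ 2
    ≡⟨ solve 2 (λ x y → x :^ 2 :* y :^ 2 := (x :* y) :^ 2) refl (N * p) b ⟩
  (N * p * b) ^ 2
    ≡⟨ cong (_^ 2) (T-scaled (suc j) (suc l) eq₁) ⟨
  (N * T n (suc l)) ^ 2
    ≡⟨ solve 2 (λ N x → (N :* x) :^ 2 := N :* N :* x :^ 2) refl N (T n (suc l)) ⟩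
  N * N * T n (suc l) ^ 2 ∎)
  where
  open ≤-Reasoning
  N p a b c : ℕ
  N = suc n
  p = N ^ l
  a = (n + j) C n
  b = (n + suc j) C n
  c = (n + suc (suc j)) C n
  eq₁ : suc j + suc l ≡ n
  eq₁ = trans (sym (+-suc j (suc l))) eq
  eq₂ : suc (suc j) + l ≡ n
  eq₂ = trans (sym (+-suc (suc j) l)) eq₁

corollary7p8 : ∀ (n : ℕ) → 2 ≤ n → LogConcave n (λ i → T n (n ∸ i))
-- The bound `i<n` reads `suc (suc j) ≤ n`; its gap `l` is what `n ∸ (i + 1)` evaluates to at
-- `i = suc j`.
corollary7p8 n _ (suc j) _ i<n with l , refl ← m≤n⇒∃[o]m+o≡n i<n = begin
  T n (n ∸ j) * T n (n ∸ (suc j + 1))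
    ≡⟨ cong₂ (λ x y → T n x * T n y) (n∸ j (suc (suc l)) eq)
         (n∸ (suc j + 1) l (cong (_+ l) (+-comm (suc j) 1))) ⟩
  T n (suc (suc l)) * T n l  ≤⟨ T-logConcave n j l eq ⟩
  T n (suc l) ^ 2
    ≡⟨ cong (λ x → T n x ^ 2) (n∸ (suc j) (suc l) (+-suc (suc j) l)) ⟨
  T n (n ∸ suc j) ^ 2        ∎
  where
  open ≤-Reasoning
  eq : j + suc (suc l) ≡ n
  eq = trans (+-suc j (suc l)) (+-suc (suc j) l)
  n∸ : ∀ i k → i + k ≡ n → n ∸ i ≡ k
  n∸ i k i+k≡n = trans (cong (_∸ i) (sym i+k≡n)) (m+n∸m≡n i k)
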